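{- Let $p$ be a prime and let $R$ be a NIP $\mathbb{F}_p$-algebra which is an integral domain. Then the prime ideals of $R$ are linearly ordered by inclusion.
   Context: All rings are commutative and unital. A ring is NIP if its complete theory in the language of rings is NIP. -}

module Defs where

open import Level using (Level; _⊔_) renaming (suc to lsuc)
open import Algebra.Bundles using (CommutativeRing)
open import Data.Nat using (ℕ; zero; suc) renaming (_+_ to _+ℕ_)
open import Data.Nat.Primality using (Prime)
open import Data.Fin using (Fin)
open import Data.Vec using (Vec; lookup; _++_; _∷_)
open import Data.Bool using (Bool; true)
open import Data.Product using (Σ; _×_; ∃)
open import Data.Sum using (_⊎_)
open import Data.Empty using (⊥)
open import Relation.Nullary using (¬_)
open import Relation.Binary.PropositionalEquality using (_≡_)
open import Function.Bundles using (_⇔_)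
open import Axiom.ExcludedMiddle using (ExcludedMiddle)

data Term (n : ℕ) : Set where
  var  : Fin n → Term n
  zer  : Term n
  one  : Term n
  plus : Term n → Term n → Term n
  neg  : Term n → Term n
  mul  : Term n → Term n → Term n

data Formula (n : ℕ) : Set where
  eq     : Term n → Term n → Formula n
  fls    : Formula n
  not    : Formula n → Formula n
  and    : Formula n → Formula n → Formula n
  or     : Formula n → Formula n → Formula n
  imp    : Formula n → Formula n → Formula n
  exists : Formula (suc n) → Formula n
  all : Formula (suc n) → Formula n

module Semantics {c ℓ} (R : CommutativeRing c ℓ) where
  open CommutativeRing R

  evalT : ∀ {n} → Vec Carrier n → Term n → Carrier
  evalT ρ (var i)    = lookup ρ i
  evalT ρ zer        = 0#
  evalT ρ one        = 1#
  evalT ρ (plus s t) = evalT ρ s + evalT ρ t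
  evalT ρ (neg t)    = - evalT ρ t
  evalT ρ (mul s t)  = evalT ρ s * evalT ρ t

  Sat : ∀ {n} → Vec Carrier n → Formula n → Set (c ⊔ ℓ)
  Sat ρ (eq s t)   = Level.Lift c (evalT ρ s ≈ evalT ρ t)
  Sat ρ fls        = Level.Lift (c ⊔ ℓ) ⊥
  Sat ρ (not φ)    = ¬ Sat ρ φ
  Sat ρ (and φ ψ)  = Sat ρ φ × Sat ρ ψ
  Sat ρ (or φ ψ)   = Sat ρ φ ⊎ Sat ρ ψ
  Sat ρ (imp φ ψ)  = Sat ρ φ → Sat ρ ψ
  Sat ρ (exists φ) = Σ Carrier λ a → Sat (a ∷ ρ) φ
  Sat ρ (all φ) = (a : Carrier) → Sat (a ∷ ρ) φ

  Shatters : (k m : ℕ) → Formula (k +ℕ m) → ℕ → Set (c ⊔ ℓ)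
  Shatters k m φ N =
    Σ (Fin N → Vec Carrier k) λ a →
    Σ ((Fin N → Bool) → Vec Carrier m) λ b →
      ∀ (i : Fin N) (S : Fin N → Bool) → Sat (a i ++ b S) φ ⇔ (S i ≡ true)

-- R is NIP: every partitioned formula φ(x;y) has finite VC-dimension,
-- i.e. some finite N is not shattered (in R; by compactness this is
-- equivalent to NIP of the complete theory Th(R)).
NIP : ∀ {c ℓ} → CommutativeRing c ℓ → Set (c ⊔ ℓ)
NIP R = ∀ (k m : ℕ) (φ : Formula (k +ℕ m)) → ∃ λ (N : ℕ) → ¬ Shatters k m φ N
  where open Semantics R

module _ {c ℓ} (R : CommutativeRing c ℓ) where
  open CommutativeRing R

  natCast : ℕ → Carrier
  natCast zero    = 0#
  natCast (suc n) = 1# + natCast n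

  -- R is an F_p-algebra (the F_p-algebra structure on a ring is unique and
  -- exists iff p · 1 = 0)
  IsFpAlgebra : ℕ → Set ℓ
  IsFpAlgebra p = natCast p ≈ 0#

  record IsIntegralDomain : Set (c ⊔ ℓ) where
    field
      nontrivial    : ¬ (1# ≈ 0#)
      noZeroDivisor : ∀ x y → x * y ≈ 0# → x ≈ 0# ⊎ y ≈ 0#

  record IsPrimeIdeal {ℓ'} (P : Carrier → Set ℓ') : Set (c ⊔ ℓ ⊔ ℓ') where
    field
      respects : ∀ {x y} → x ≈ y → P x → P y
      zero∈    : P 0#
      +-closed : ∀ {x y} → P x → P y → P (x + y)
      absorb   : ∀ r {x} → P x → P (r * x)
      proper   : ¬ P 1#
      prime    : ∀ x y → P (x * y) → P x ⊎ P y

_⊆ₚ_ : ∀ {a ℓ₁ ℓ₂} {A : Set a} → (A → Set ℓ₁) → (A → Set ℓ₂) → Set (a ⊔ ℓ₁ ⊔ ℓ₂)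
P ⊆ₚ Q = ∀ x → P x → Q x

{-# OPTIONS --safe #-}

-- Let a ∈ P \ Q and b ∈ Q \ P. For a finite V ⊆ R the polynomial f_V(z) = ∏ (z - v), with v ranging over
-- the 𝔽ₚ-span of V, is additive, and f_V = f_Wᵖ - d^(p-1) f_W whenever V = W ∪ {c} and d = f_W(c).
-- Take V = {s c₀ , … , s c_(N-1)} with cᵢ = a^(N-1-i) bⁱ, α = a^M, β = b^M, s = α + β, and put
-- zᵢ = cᵢ β ≡ 0 (mod β), so that zᵢ ≡ s cᵢ (mod α). With Wⱼ = V \ {s cⱼ} and dⱼ = f_Wⱼ(s cⱼ) this gives
-- f_Wⱼ(zᵢ) ∈ αR ∩ βR for i ≠ j, while f_Wᵢ(zᵢ) ≡ dᵢ (mod α). The cᵢ have distinct orders at P and at Q, so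
-- the orders of the dᵢ are bounded independently of M, and for large M the element tᵢ = f_V(zᵢ)
-- lies in the subgroup { uᵖ - dⱼ^(p-1) u : u ∈ αR ∩ βR } exactly when i ≠ j. Hence the sums of the tᵢ
-- witness that this uniformly definable family of subgroups shatters sets of every finite size N.

module Submission where

open import Defs
open import Level using (Level; _⊔_; Lift; lift; lower)
open import Algebra.Bundles using (CommutativeRing; RawRing)
open import Algebra.Solver.Ring.AlmostCommutativeRing using (fromCommutativeRing; _-Raw-AlmostCommutative⟶_)
import Algebra.Solver.Ring
import Algebra.Properties.AbelianGroup
import Algebra.Properties.CommutativeSemigroup
import Algebra.Properties.CommutativeSemiring.Exp
import Algebra.Properties.CommutativeSemiring.Binomial
import Algebra.Properties.Group
import Algebra.Properties.Monoid.Mult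
import Algebra.Properties.Ring
import Algebra.Properties.Semiring.Divisibility
import Algebra.Properties.Semiring.Mult
import Algebra.Properties.Semiring.Mult.TCOptimised
import Algebra.Properties.CommutativeMonoid.Sum
open import Data.Bool using (Bool; true; false; if_then_else_)
open import Data.Empty using (⊥-elim)
open import Data.Fin using (Fin; zero; suc; toℕ; opposite; #_; fromℕ; inject₁)
import Data.Fin.Properties as Fin
open import Data.List using (List; []; _∷_; map; allFin; length) renaming (_++_ to _++ₗ_)
import Data.List.Properties as List
open import Data.List.Membership.Propositional using (_∈_)
open import Data.List.Membership.Propositional.Properties using (∈-∃++; ∈-allFin; ∈-map⁺)
open import Data.List.Relation.Binary.Permutation.Propositional.Properties using (map⁺; shift; ∈-resp-↭; ↭-length)
open import Data.List.Relation.Binary.Permutation.Setoid.Properties using (Unique-resp-↭)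
open import Data.List.Relation.Unary.Unique.Propositional.Properties using (allFin⁺)
open import Data.List.Relation.Binary.Permutation.Propositional as ↭ using (_↭_)
open import Data.List.Relation.Unary.All using ([]; _∷_)
open import Data.List.Relation.Unary.Any using (here; there)
open import Data.List.Relation.Unary.AllPairs using ([]; _∷_)
open import Data.List.Relation.Unary.Unique.Propositional using (Unique)
open import Data.Maybe using (Maybe; just; nothing)
open import Data.Nat using (ℕ; zero; suc; _≤_; _<_; _⊓_; s≤s; z≤n; _!; nonTrivial⇒≢1)
import Data.Nat as ℕ
import Data.Nat.Properties as ℕ
open import Data.Nat.Properties using (_!*_!≢0)
import Data.Nat.Divisibility as ℕ
open import Data.Nat.Combinatorics using (_C_; nCn≡1; nCk≡n!/k![n-k]!; k![n∸k]!∣n!)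
open import Data.Nat.DivMod using (m/n*n≡m)
open import Data.Nat.Primality using (Prime; euclidsLemma; prime⇒nonTrivial; ¬prime[0]; ¬prime[1])
open import Data.Product using (∃; ∃₂; _×_; _,_; proj₁; proj₂)
open import Data.Sum using (_⊎_; inj₁; inj₂; [_,_]′)
open import Data.Vec using (Vec; []; _∷_; _++_)
open import Function using (_∘_; id)
open import Function.Bundles using (_⇔_; mk⇔; Equivalence)
open Equivalence using (to; from)
open import Relation.Nullary.Decidable using (decidable-stable)
open import Relation.Nullary using (¬_; yes; no; Dec)
open import Relation.Binary.Definitions using (tri<; tri≈; tri>)
open import Relation.Binary.PropositionalEquality as ≡ using (_≡_; _≢_)
open import Axiom.ExcludedMiddle using (ExcludedMiddle)

-- Deciding identities in commutative rings.

-- A ring solver whose coefficients are formal differences (m , n) of naturals,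
-- so that cancellation is decidable in an arbitrary commutative ring.
module RingSolver {c ℓ} (R : CommutativeRing c ℓ) where
  open CommutativeRing R
  open Algebra.Properties.AbelianGroup +-abelianGroup using (⁻¹-anti-homo‿-; ⁻¹-∙-comm)
  open Algebra.Properties.Ring ring using (x[y-z]≈xy-xz; [y-z]x≈yx-zx)
  open Algebra.Properties.CommutativeSemigroup
    (CommutativeRing.+-commutativeSemigroup R) using (interchange)
  open Algebra.Properties.Semiring.Mult.TCOptimised semiring
    using (×-homo-+; ×1-homo-*) renaming (_×_ to _×′_)
  open import Relation.Binary.Reasoning.Setoid setoid

  difference : ℕ × ℕ → Carrier
  difference (m , n) = m ×′ 1# - n ×′ 1#

  -‿interchange : ∀ x y z w → (x + y) - (z + w) ≈ (x - z) + (y - w)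
  -‿interchange x y z w = begin
    (x + y) - (z + w)     ≈⟨ +-congˡ (⁻¹-∙-comm z w) ⟨
    (x + y) + (- z - w)   ≈⟨ interchange x y (- z) (- w) ⟩
    (x - z) + (y - w)     ∎

  *‿difference : ∀ x y z w → (x * z + y * w) - (x * w + y * z) ≈ (x - y) * (z - w)
  *‿difference x y z w = begin
    (x * z + y * w) - (x * w + y * z)   ≈⟨ -‿interchange _ _ _ _ ⟩
    (x * z - x * w) + (y * w - y * z)   ≈⟨ +-congˡ (⁻¹-anti-homo‿- _ _) ⟨
    (x * z - x * w) - (y * z - y * w)   ≈⟨ +-cong (x[y-z]≈xy-xz x z w) (-‿cong (x[y-z]≈xy-xz y z w)) ⟨
    x * (z - w) - y * (z - w)           ≈⟨ [y-z]x≈yx-zx (z - w) x y ⟨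
    (x - y) * (z - w)                   ∎

  coefficients : RawRing _ _
  coefficients = record
    { Carrier = ℕ × ℕ
    ; _≈_     = _≡_
    ; _+_     = λ (m , n) (k , l) → m ℕ.+ k , n ℕ.+ l
    ; _*_     = λ (m , n) (k , l) → m ℕ.* k ℕ.+ n ℕ.* l , m ℕ.* l ℕ.+ n ℕ.* k
    ; -_      = λ (m , n) → n , m
    ; 0#      = 0 , 0
    ; 1#      = 1 , 0
    }

  ×1-homo : ∀ m n k l → (m ℕ.* n ℕ.+ k ℕ.* l) ×′ 1# ≈ m ×′ 1# * n ×′ 1# + k ×′ 1# * l ×′ 1#
  ×1-homo m n k l = trans (×-homo-+ 1# (m ℕ.* n) (k ℕ.* l)) (+-cong (×1-homo-* m n) (×1-homo-* k l))

  difference-homomorphism : coefficients -Raw-AlmostCommutative⟶ fromCommutativeRing R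
  difference-homomorphism = record
    { ⟦_⟧    = difference
    ; +-homo = λ (m , n) (k , l) →
        trans (+-cong (×-homo-+ 1# m k) (-‿cong (×-homo-+ 1# n l))) (-‿interchange _ _ _ _)
    ; *-homo = λ (m , n) (k , l) →
        trans (+-cong (×1-homo m k n l) (-‿cong (×1-homo m l n k))) (*‿difference _ _ _ _)
    ; -‿homo = λ (m , n) → sym (⁻¹-anti-homo‿- _ _)
    ; 0-homo = -‿inverseʳ 0#
    ; 1-homo = trans (+-congˡ (trans (sym (+-identityˡ _)) (-‿inverseʳ 0#))) (+-identityʳ 1#)
    }

  -- Only equality of formal differences is tested. In characteristic `p` distinct ones may have
  -- equal images, so a failed test proves nothing.
  difference-≟ : ∀ x y → Maybe (difference x ≈ difference y)
  difference-≟ (m , n) (k , l) with m ℕ.+ l ℕ.≟ k ℕ.+ n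
  ... | no  _  = nothing
  ... | yes m+l≡k+n = just (begin
    m ×′ 1# - n ×′ 1#                           ≈⟨ +-identityʳ _ ⟨
    (m ×′ 1# - n ×′ 1#) + 0#                    ≈⟨ +-congˡ (-‿inverseʳ (l ×′ 1#)) ⟨
    (m ×′ 1# - n ×′ 1#) + (l ×′ 1# - l ×′ 1#)   ≈⟨ -‿interchange _ _ _ _ ⟨
    (m ×′ 1# + l ×′ 1#) - (n ×′ 1# + l ×′ 1#)   ≈⟨ +-congʳ (×-homo-+ 1# m l) ⟨
    (m ℕ.+ l) ×′ 1# - (n ×′ 1# + l ×′ 1#)       ≡⟨ ≡.cong (λ z → z ×′ 1# - (n ×′ 1# + l ×′ 1#)) m+l≡k+n ⟩
    (k ℕ.+ n) ×′ 1# - (n ×′ 1# + l ×′ 1#)       ≈⟨ +-cong (×-homo-+ 1# k n) (-‿cong (+-comm _ _)) ⟩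
    (k ×′ 1# + n ×′ 1#) - (l ×′ 1# + n ×′ 1#)   ≈⟨ -‿interchange _ _ _ _ ⟩
    (k ×′ 1# - l ×′ 1#) + (n ×′ 1# - n ×′ 1#)   ≈⟨ +-congˡ (-‿inverseʳ (n ×′ 1#)) ⟩
    (k ×′ 1# - l ×′ 1#) + 0#                    ≈⟨ +-identityʳ _ ⟩
    k ×′ 1# - l ×′ 1#                           ∎)

  open Algebra.Solver.Ring coefficients (fromCommutativeRing R) difference-homomorphism difference-≟ public
    using (solve; _:=_; _:+_; _:*_; :-_; _:-_)

-- Prime divisors of binomial coefficients.

n∣n! : ∀ n → 0 < n → n ℕ.∣ n !
n∣n! (suc n) _ = ℕ.m∣m*n (n !)

p∣m!⇒p≤m : ∀ {p} → Prime p → ∀ m → p ℕ.∣ m ! → p ≤ m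
p∣m!⇒p≤m prime-p zero    p∣1 = ⊥-elim (nonTrivial⇒≢1 {{prime⇒nonTrivial prime-p}} (ℕ.∣1⇒≡1 p∣1))
p∣m!⇒p≤m prime-p (suc m) p∣m! with euclidsLemma (suc m) (m !) prime-p p∣m!
... | inj₁ p∣sm = ℕ.∣⇒≤ p∣sm
... | inj₂ p∣m!′ = ℕ.m≤n⇒m≤1+n (p∣m!⇒p≤m prime-p m p∣m!′)

-- `p` divides `p !`, the product of `p C k` with `k !` and `(p ∸ k) !`, and these two factorials
-- only have factors below `p`.
p∣pCk : ∀ {p k} → Prime p → 0 < k → k < p → p ℕ.∣ p C k
p∣pCk {p} {k} prime-p 0<k k<p
  with euclidsLemma (p C k) (k ! ℕ.* (p ℕ.∸ k) !) prime-p p∣product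
  where
    k≤p = ℕ.<⇒≤ k<p
    instance _ = k !* (p ℕ.∸ k) !≢0
    product≡p! : (p C k) ℕ.* (k ! ℕ.* (p ℕ.∸ k) !) ≡ p !
    product≡p! = ≡.trans (≡.cong (λ z → z ℕ.* (k ! ℕ.* (p ℕ.∸ k) !)) (nCk≡n!/k![n-k]! k≤p)) (m/n*n≡m (k![n∸k]!∣n! k≤p))
    p∣product : p ℕ.∣ (p C k) ℕ.* (k ! ℕ.* (p ℕ.∸ k) !)
    p∣product = ≡.subst (p ℕ.∣_) (≡.sym product≡p!) (n∣n! p (ℕ.≤-<-trans z≤n k<p))
... | inj₁ p∣C = p∣C
... | inj₂ p∣k![p-k]! with euclidsLemma (k !) ((p ℕ.∸ k) !) prime-p p∣k![p-k]!
...   | inj₁ p∣k! = ⊥-elim (ℕ.<⇒≱ k<p (p∣m!⇒p≤m prime-p k p∣k!))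
...   | inj₂ p∣[p-k]! = ⊥-elim (ℕ.<⇒≱ (ℕ.∸-monoʳ-< 0<k (ℕ.<⇒≤ k<p)) (p∣m!⇒p≤m prime-p (p ℕ.∸ k) p∣[p-k]!))

-- The Frobenius endomorphism.

module Frobenius {c ℓ} (R : CommutativeRing c ℓ) (m : ℕ)
  (prime-p : Prime (suc (suc m))) (char-p : IsFpAlgebra R (suc (suc m))) where
  open CommutativeRing R hiding (zero)
  open Algebra.Properties.CommutativeSemiring.Exp commutativeSemiring
  open Algebra.Properties.CommutativeSemiring.Binomial commutativeSemiring
    using (binomial; binomialTerm) renaming (theorem to binomial-theorem)
  open Algebra.Properties.Monoid.Mult +-monoid using (×-congʳ; ×-assocˡ; ×-homo-1)
  open Algebra.Properties.Semiring.Mult semiring using (×-assoc-*) renaming (_×_ to _·_)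
  open Algebra.Properties.CommutativeMonoid.Sum +-commutativeMonoid
    using (sum; sum-init-last; sum-cong-≋; sum-replicate-zero)
  open Algebra.Properties.Group +-group using (inverseˡ-unique; ⁻¹-injective)
  open Algebra.Properties.Ring ring using (-1*x≈-x)
  open import Relation.Binary.Reasoning.Setoid setoid

  -- With `p` of the form `suc n`, `x ^ p` unfolds to `x * x ^ n`; `n` being a successor, it is
  -- visibly positive for the strict order estimates.
  n p : ℕ
  n = suc m
  p = suc n

  natCast≡·1 : ∀ k → natCast R k ≡ k · 1#
  natCast≡·1 zero    = ≡.refl
  natCast≡·1 (suc k) = ≡.cong (1# +_) (natCast≡·1 k)

  p·x≈0 : ∀ x → p · x ≈ 0#
  p·x≈0 x = begin
    p · x            ≈⟨ ×-congʳ p (*-identityˡ x) ⟨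
    p · (1# * x)     ≈⟨ ×-assoc-* p 1# x ⟨
    (p · 1#) * x     ≈⟨ *-congʳ (trans (reflexive (≡.sym (natCast≡·1 p))) char-p) ⟩
    0# * x           ≈⟨ zeroˡ x ⟩
    0#               ∎

  p∣k⇒k·x≈0 : ∀ {k} x → p ℕ.∣ k → k · x ≈ 0#
  p∣k⇒k·x≈0 x (ℕ.divides q ≡.refl) = begin
    (q ℕ.* p) · x   ≡⟨ ≡.cong (_· x) (ℕ.*-comm q p) ⟩
    (p ℕ.* q) · x   ≈⟨ ×-assocˡ x p q ⟨
    p · (q · x)     ≈⟨ p·x≈0 (q · x) ⟩
    0#              ∎

  ^p-+ : ∀ x y → (x + y) ^ p ≈ x ^ p + y ^ p
  ^p-+ x y = begin
    (x + y) ^ p                                       ≈⟨ binomial-theorem p x y ⟩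
    first + sum (λ i → term (suc i))                  ≈⟨ +-congˡ (sum-init-last (λ i → term (suc i))) ⟩
    first + (sum (λ i → term (suc (inject₁ i))) + last) ≈⟨ +-congˡ (+-congʳ middle≈0) ⟩
    first + (0# + last)                               ≈⟨ +-cong first≈y^p (trans (+-identityˡ last) last≈x^p) ⟩
    y ^ p + x ^ p                                     ≈⟨ +-comm _ _ ⟩
    x ^ p + y ^ p                                     ∎
    where
    term : Fin (suc p) → Carrier
    term = binomialTerm x y p

    first last : Carrier
    first = term zero
    last  = term (suc (fromℕ n))

    first≈y^p : first ≈ y ^ p
    first≈y^p = trans (×-homo-1 _) (*-identityˡ _)

    last≈x^p : last ≈ x ^ p
    last≈x^p = begin
      (p C toℕ (fromℕ p)) · (x ^ toℕ (fromℕ p) * y ^ (p ℕ.∸ toℕ (fromℕ p)))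
        ≡⟨ ≡.cong (λ k → (p C k) · (x ^ k * y ^ (p ℕ.∸ k))) (Fin.toℕ-fromℕ p) ⟩
      (p C p) · (x ^ p * y ^ (p ℕ.∸ p))
        ≡⟨ ≡.cong₂ (λ k l → k · (x ^ p * y ^ l)) (nCn≡1 p) (ℕ.n∸n≡0 p) ⟩
      1 · (x ^ p * 1#)
        ≈⟨ trans (×-homo-1 _) (*-identityʳ _) ⟩
      x ^ p
        ∎

    middle≈0 : sum (λ i → term (suc (inject₁ i))) ≈ 0#
    middle≈0 = trans
      -- The index is `1 + toℕ i` with `i : Fin n`, hence strictly between `0` and `p`.
      (sum-cong-≋ λ i → p∣k⇒k·x≈0 (binomial x y p (suc (inject₁ i))) (p∣pCk prime-p (s≤s z≤n)
        (s≤s (≡.subst (_< n) (≡.sym (Fin.toℕ-inject₁ i)) (Fin.toℕ<n i)))))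
      (sum-replicate-zero n)

  0^p≈0 : 0# ^ p ≈ 0#
  0^p≈0 = zeroˡ _

  ^p-neg : ∀ x → (- x) ^ p ≈ - (x ^ p)
  ^p-neg x = inverseˡ-unique _ _ (begin
    (- x) ^ p + x ^ p   ≈⟨ ^p-+ (- x) x ⟨
    (- x + x) ^ p       ≈⟨ ^-congˡ p (-‿inverseˡ x) ⟩
    0# ^ p              ≈⟨ 0^p≈0 ⟩
    0#                  ∎)

  1^k≈1 : ∀ k → 1# ^ k ≈ 1#
  1^k≈1 zero    = refl
  1^k≈1 (suc k) = trans (*-identityˡ _) (1^k≈1 k)

  -- Cancelling a sign in `(- 1#) ^ p ≈ - 1#` avoids a parity argument and so covers `p = 2`, where
  -- `n` is odd.
  [-1]^n≈1 : (- 1#) ^ n ≈ 1#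
  [-1]^n≈1 = ⁻¹-injective (begin
    - ((- 1#) ^ n)   ≈⟨ -1*x≈-x _ ⟨
    (- 1#) ^ p       ≈⟨ ^p-neg 1# ⟩
    - (1# ^ p)       ≈⟨ -‿cong (1^k≈1 p) ⟩
    - 1#             ∎)

  ^n-even : ∀ x → (- x) ^ n ≈ x ^ n
  ^n-even x = begin
    (- x) ^ n            ≈⟨ ^-congˡ n (-1*x≈-x x) ⟨
    (- 1# * x) ^ n       ≈⟨ ^-distrib-* (- 1#) x n ⟩
    (- 1#) ^ n * x ^ n   ≈⟨ *-congʳ [-1]^n≈1 ⟩
    1# * x ^ n           ≈⟨ *-identityˡ _ ⟩
    x ^ n                ∎

-- Additive polynomials with prescribed roots.

module AdditivePolynomials {c ℓ} (R : CommutativeRing c ℓ) (domain : IsIntegralDomain R) (m : ℕ)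
  (prime-p : Prime (suc (suc m))) (char-p : IsFpAlgebra R (suc (suc m))) where
  open CommutativeRing R hiding (zero)
  open Frobenius R m prime-p char-p
  open IsIntegralDomain domain
  open RingSolver R
  open Algebra.Properties.CommutativeSemiring.Exp commutativeSemiring
  open Algebra.Properties.Group +-group using (x∙y⁻¹≈ε⇒x≈y)
  open Algebra.Properties.Ring ring using (-0#≈0#)
  open Algebra.Properties.Semiring.Divisibility semiring using (_∣_; _,_)
  open import Relation.Binary.Reasoning.Setoid setoid

  -- For `δ = γ ^ n` this is the product of the `x - kγ` over `k` in `𝔽ₚ`, a homogeneous
  -- Artin-Schreier polynomial.
  AS : Carrier → Carrier → Carrier
  AS δ x = x ^ p - δ * x

  AS-cong : ∀ {δ ε x y} → δ ≈ ε → x ≈ y → AS δ x ≈ AS ε y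
  AS-cong δ≈ε x≈y = +-cong (^-congˡ p x≈y) (-‿cong (*-cong δ≈ε x≈y))

  AS-+ : ∀ δ x y → AS δ (x + y) ≈ AS δ x + AS δ y
  AS-+ δ x y = trans (+-congʳ (^p-+ x y))
    (solve 5 (λ δ x y xp yp → (xp :+ yp) :- δ :* (x :+ y) := (xp :- δ :* x) :+ (yp :- δ :* y))
      refl δ x y (x ^ p) (y ^ p))

  AS-neg : ∀ δ x → AS δ (- x) ≈ - AS δ x
  AS-neg δ x = trans (+-congʳ (^p-neg x))
    (solve 3 (λ δ x xp → :- xp :- δ :* :- x := :- (xp :- δ :* x)) refl δ x (x ^ p))

  AS-0 : ∀ δ → AS δ 0# ≈ 0#
  AS-0 δ = trans
    (solve 3 (λ δ z zn → z :* zn :- δ :* z := z :* (zn :- δ)) refl δ 0# (0# ^ n))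
    (zeroˡ _)

  AS-self : ∀ x → AS (x ^ n) x ≈ 0#
  AS-self x = trans (+-congʳ (*-comm _ _)) (-‿inverseʳ _)

  AS-∣ : ∀ {δ x y} → x ∣ y → x ∣ AS δ y
  AS-∣ {δ} {x} {y} (q , qx≈y) = q * (y ^ n - δ) , (begin
    q * (y ^ n - δ) * x      ≈⟨ solve 4 (λ q yn δ x → q :* (yn :- δ) :* x := q :* x :* yn :- δ :* (q :* x)) refl q (y ^ n) δ x ⟩
    q * x * y ^ n - δ * (q * x) ≈⟨ +-cong (*-congʳ qx≈y) (-‿cong (*-congˡ qx≈y)) ⟩
    AS δ y                   ∎)

  -- The coefficient of xᵖ in AS (γⁿ) (AS (αⁿ) x), negated, where γ = AS (αⁿ) β. It is symmetric
  -- in α and β because both αγ and its product with αγ are antisymmetric.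
  middle : Carrier → Carrier → Carrier
  middle α β = AS (α ^ n) β ^ n + (α ^ n) ^ p

  middle-cong : ∀ {α α′ β β′} → α ≈ α′ → β ≈ β′ → middle α β ≈ middle α′ β′
  middle-cong α≈ β≈ = +-cong (^-congˡ n (AS-cong (^-congˡ n α≈) β≈)) (^-congˡ p (^-congˡ n α≈))

  AS-AS : ∀ α β x → AS (AS (α ^ n) β ^ n) (AS (α ^ n) x) ≈
                    ((x ^ p) ^ p - middle α β * x ^ p) + (α * AS (α ^ n) β) ^ n * x
  AS-AS α β x = begin
    AS (α ^ n) x ^ p - γ^n * AS (α ^ n) x
      ≈⟨ +-congʳ (trans (^p-+ _ _) (+-congˡ (trans (^p-neg _) (-‿cong (^-distrib-* (α ^ n) x p))))) ⟩
    ((x ^ p) ^ p - (α ^ n) ^ p * x ^ p) - γ^n * (x ^ p - α ^ n * x)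
      ≈⟨ solve 6 (λ xpp αnp xp γn αn x →
           (xpp :- αnp :* xp) :- γn :* (xp :- αn :* x) := (xpp :- (γn :+ αnp) :* xp) :+ αn :* γn :* x)
         refl ((x ^ p) ^ p) ((α ^ n) ^ p) (x ^ p) γ^n (α ^ n) x ⟩
    ((x ^ p) ^ p - middle α β * x ^ p) + α ^ n * γ^n * x
      ≈⟨ +-congˡ (*-congʳ (^-distrib-* α _ n)) ⟨
    ((x ^ p) ^ p - middle α β * x ^ p) + (α * AS (α ^ n) β) ^ n * x
      ∎
    where γ^n = AS (α ^ n) β ^ n

  -- The left side is the Moore determinant `αβᵖ - αᵖβ`.
  αAS-antisym : ∀ α β → α * AS (α ^ n) β ≈ - (β * AS (β ^ n) α)
  αAS-antisym α β = solve 4 (λ α αn β βn →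
    α :* (β :* βn :- αn :* β) := :- (β :* (α :* αn :- βn :* α))) refl α (α ^ n) β (β ^ n)

  αAS*middle : ∀ α β → α * AS (α ^ n) β * middle α β ≈ α * (β ^ p) ^ p - β * (α ^ p) ^ p
  αAS*middle α β = begin
    α * γ * (γ ^ n + (α ^ n) ^ p)
      ≈⟨ solve 4 (λ α γ γn αnp → α :* γ :* (γn :+ αnp) := α :* (γ :* γn) :+ α :* γ :* αnp)
         refl α γ (γ ^ n) ((α ^ n) ^ p) ⟩
    α * γ ^ p + α * γ * (α ^ n) ^ p
      ≈⟨ +-congʳ (*-congˡ (trans (^p-+ _ _) (+-congˡ (trans (^p-neg _) (-‿cong (^-distrib-* (α ^ n) β p)))))) ⟩
    α * ((β ^ p) ^ p - (α ^ n) ^ p * β ^ p) + α * γ * (α ^ n) ^ p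
      ≈⟨ solve 6 (λ α αn β βp βpp αnp →
           α :* (βpp :- αnp :* βp) :+ α :* (βp :- αn :* β) :* αnp := α :* βpp :- β :* (α :* αn :* αnp))
         refl α (α ^ n) β (β ^ p) ((β ^ p) ^ p) ((α ^ n) ^ p) ⟩
    α * (β ^ p) ^ p - β * (α ^ p * (α ^ n) ^ p)
      ≡⟨⟩
    α * (β ^ p) ^ p - β * ((α ^ p) * (α ^ n) ^ p)
      ≈⟨ +-congˡ (-‿cong (*-congˡ (^-distrib-* α (α ^ n) p))) ⟨
    α * (β ^ p) ^ p - β * (α ^ p) ^ p
      ∎
    where γ = AS (α ^ n) β

  middle-sym-0 : ∀ β → middle 0# β ≈ middle β 0#
  middle-sym-0 β = begin
    AS (0# ^ n) β ^ n + (0# ^ n) ^ p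
      ≈⟨ +-cong (^-congˡ n (trans (AS-cong (zeroˡ _) refl) (trans (+-congˡ (trans (-‿cong (zeroˡ β)) -0#≈0#)) (+-identityʳ _))))
                (trans (^-congˡ p (zeroˡ _)) (zeroˡ _)) ⟩
    (β ^ p) ^ n + 0#
      ≈⟨ +-comm _ _ ⟩
    0# + (β ^ p) ^ n
      ≈⟨ +-cong (sym (trans (^-congˡ n (AS-0 _)) (zeroˡ _)))
                (trans (^-assocʳ β p n) (trans (^-congʳ β (ℕ.*-comm p n)) (sym (^-assocʳ β n p)))) ⟩
    AS (β ^ n) 0# ^ n + (β ^ n) ^ p
      ∎

  -- Multiplication by `αγ` reduces the claim to `αAS-antisym` and `αAS*middle`, and a nonzero
  -- factor cancels in a domain. If the factor vanishes, then `α = 0`, `β = 0` or `αⁿ = βⁿ`, and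
  -- each case is computed directly.
  middle-sym : ∀ α β → middle α β ≈ middle β α
  middle-sym α β = [ degenerate , x∙y⁻¹≈ε⇒x≈y _ _ ]′ (noZeroDivisor (α * AS (α ^ n) β) _ (begin
    α * AS (α ^ n) β * (middle α β - middle β α)
      ≈⟨ solve 3 (λ e x y → e :* (x :- y) := e :* x :- e :* y) refl _ _ _ ⟩
    α * AS (α ^ n) β * middle α β - α * AS (α ^ n) β * middle β α
      ≈⟨ +-cong (αAS*middle α β) (-‿cong (*-congʳ (αAS-antisym α β))) ⟩
    (α * (β ^ p) ^ p - β * (α ^ p) ^ p) - - (β * AS (β ^ n) α) * middle β α
      ≈⟨ solve 3 (λ d e y → d :- :- e :* y := d :+ e :* y) refl _ _ _ ⟩
    (α * (β ^ p) ^ p - β * (α ^ p) ^ p) + β * AS (β ^ n) α * middle β α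
      ≈⟨ +-congˡ (αAS*middle β α) ⟩
    (α * (β ^ p) ^ p - β * (α ^ p) ^ p) + (β * (α ^ p) ^ p - α * (β ^ p) ^ p)
      ≈⟨ solve 2 (λ x y → (x :- y) :+ (y :- x) := x :- x) refl _ _ ⟩
    α * (β ^ p) ^ p - α * (β ^ p) ^ p
      ≈⟨ -‿inverseʳ _ ⟩
    0#
      ∎))
    where
    equal-powers : α ^ n ≈ β ^ n → middle α β ≈ middle β α
    equal-powers αⁿ≈βⁿ = +-cong
      (^-congˡ n (trans (trans (AS-cong αⁿ≈βⁿ refl) (AS-self β))
        (sym (trans (AS-cong (sym αⁿ≈βⁿ) refl) (AS-self α)))))
      (^-congˡ p αⁿ≈βⁿ)

    degenerate : α * AS (α ^ n) β ≈ 0# → middle α β ≈ middle β α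
    degenerate e≈0 with noZeroDivisor _ _ e≈0
    ... | inj₁ α≈0 = trans (middle-cong α≈0 refl) (trans (middle-sym-0 β) (middle-cong refl (sym α≈0)))
    ... | inj₂ γ≈0 with noZeroDivisor β (β ^ n - α ^ n)
                          (trans (solve 3 (λ β βn αn → β :* (βn :- αn) := β :* βn :- αn :* β) refl _ _ _) γ≈0)
    ...   | inj₁ β≈0 = trans (middle-cong refl β≈0) (trans (sym (middle-sym-0 α)) (middle-cong (sym β≈0) refl))
    ...   | inj₂ βⁿ≈αⁿ = equal-powers (sym (x∙y⁻¹≈ε⇒x≈y _ _ βⁿ≈αⁿ))

  -- The middle coefficients agree by symmetry, the linear ones because `n`-th powers ignore the
  -- sign of `αγ`.
  AS-AS-comm : ∀ α β x → AS (AS (α ^ n) β ^ n) (AS (α ^ n) x) ≈ AS (AS (β ^ n) α ^ n) (AS (β ^ n) x)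
  AS-AS-comm α β x = begin
    AS (AS (α ^ n) β ^ n) (AS (α ^ n) x)
      ≈⟨ AS-AS α β x ⟩
    ((x ^ p) ^ p - middle α β * x ^ p) + (α * AS (α ^ n) β) ^ n * x
      ≈⟨ +-cong (+-congˡ (-‿cong (*-congʳ (middle-sym α β))))
                (*-congʳ (trans (^-congˡ n (αAS-antisym α β)) (^n-even _))) ⟩
    ((x ^ p) ^ p - middle β α * x ^ p) + (β * AS (β ^ n) α) ^ n * x
      ≈⟨ AS-AS β α x ⟨
    AS (AS (β ^ n) α ^ n) (AS (β ^ n) x)
      ∎

  -- The monic additive polynomial z ↦ ∏ (z - w), with w ranging over the 𝔽ₚ-span of W.
  spanPoly : List Carrier → Carrier → Carrier
  spanPoly []      z = z
  spanPoly (c ∷ W) z = AS (spanPoly W c ^ n) (spanPoly W z)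

  spanPoly-cong : ∀ W {x y} → x ≈ y → spanPoly W x ≈ spanPoly W y
  spanPoly-cong []      x≈y = x≈y
  spanPoly-cong (c ∷ W) x≈y = AS-cong refl (spanPoly-cong W x≈y)

  spanPoly-+ : ∀ W x y → spanPoly W (x + y) ≈ spanPoly W x + spanPoly W y
  spanPoly-+ []      x y = refl
  spanPoly-+ (c ∷ W) x y = trans (AS-cong refl (spanPoly-+ W x y)) (AS-+ _ _ _)

  spanPoly-∣ : ∀ W {x y} → x ∣ y → x ∣ spanPoly W y
  spanPoly-∣ []      x∣y = x∣y
  spanPoly-∣ (c ∷ W) x∣y = AS-∣ (spanPoly-∣ W x∣y)

  spanPoly-root : ∀ {W c} → c ∈ W → spanPoly W c ≈ 0#
  spanPoly-root {c ∷ W} (here ≡.refl) = AS-self _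
  spanPoly-root {_ ∷ W} (there c∈W)   = trans (AS-cong refl (spanPoly-root c∈W)) (AS-0 _)

  -- The recursion reads the list in order; invariance allows any generator to be moved to the head.
  -- Swaps of neighbours are `AS-AS-comm`.
  spanPoly-↭ : ∀ {V W} → V ↭ W → ∀ z → spanPoly V z ≈ spanPoly W z
  spanPoly-↭ ↭.refl         z = refl
  spanPoly-↭ (↭.prep c V↭W) z = AS-cong (^-congˡ n (spanPoly-↭ V↭W c)) (spanPoly-↭ V↭W z)
  spanPoly-↭ {_ ∷ _ ∷ V} (↭.swap c d V↭W) z = trans
    (AS-AS-comm (spanPoly V d) (spanPoly V c) (spanPoly V z))
    (AS-cong (^-congˡ n (AS-cong (^-congˡ n (spanPoly-↭ V↭W c)) (spanPoly-↭ V↭W d)))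
             (AS-cong (^-congˡ n (spanPoly-↭ V↭W c)) (spanPoly-↭ V↭W z)))
  spanPoly-↭ (↭.trans U↭V V↭W) z = trans (spanPoly-↭ U↭V z) (spanPoly-↭ V↭W z)

-- Cancellation in domains and complements of prime ideals.

module Domain {c ℓ} (R : CommutativeRing c ℓ) (domain : IsIntegralDomain R) where
  open CommutativeRing R hiding (zero)
  open IsIntegralDomain domain
  open RingSolver R
  open Algebra.Properties.CommutativeSemiring.Exp commutativeSemiring
  open Algebra.Properties.Group +-group using (x∙y⁻¹≈ε⇒x≈y; x≈y⇒x∙y⁻¹≈ε)

  *-cancelˡ : ∀ {x y z} → x ≉ 0# → x * y ≈ x * z → y ≈ z
  *-cancelˡ {x} {y} {z} x≉0 xy≈xz with noZeroDivisor x (y - z)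
    (trans (solve 3 (λ x y z → x :* (y :- z) := x :* y :- x :* z) refl x y z) (x≈y⇒x∙y⁻¹≈ε xy≈xz))
  ... | inj₁ x≈0   = ⊥-elim (x≉0 x≈0)
  ... | inj₂ y-z≈0 = x∙y⁻¹≈ε⇒x≈y y z y-z≈0

  ^-≉0 : ∀ {x} → x ≉ 0# → ∀ k → x ^ k ≉ 0#
  ^-≉0 x≉0 zero    1≈0 = nontrivial 1≈0
  ^-≉0 x≉0 (suc k) x^k≈0 = [ x≉0 , ^-≉0 x≉0 k ]′ (noZeroDivisor _ _ x^k≈0)

module PrimeIdeal {c ℓ ℓ'} (R : CommutativeRing c ℓ) (Q : CommutativeRing.Carrier R → Set ℓ')
  (prime-Q : IsPrimeIdeal R Q) where
  open CommutativeRing R hiding (zero)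
  open IsPrimeIdeal prime-Q
  open RingSolver R
  open Algebra.Properties.CommutativeSemiring.Exp commutativeSemiring
  open Algebra.Properties.Ring ring using (-1*x≈-x)

  neg-closed : ∀ {x} → Q x → Q (- x)
  neg-closed x∈Q = respects (-1*x≈-x _) (absorb (- 1#) x∈Q)

  absorbʳ : ∀ {x} r → Q x → Q (x * r)
  absorbʳ r x∈Q = respects (*-comm r _) (absorb r x∈Q)

  ∉-+ : ∀ {x y} → ¬ Q x → Q y → ¬ Q (x + y)
  ∉-+ {x} {y} x∉Q y∈Q x+y∈Q =
    x∉Q (respects (solve 2 (λ x y → (x :+ y) :- y := x) refl x y) (+-closed x+y∈Q (neg-closed y∈Q)))

  ∉-* : ∀ {x y} → ¬ Q x → ¬ Q y → ¬ Q (x * y)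
  ∉-* x∉Q y∉Q xy∈Q = [ x∉Q , y∉Q ]′ (prime _ _ xy∈Q)

  ∉-^ : ∀ {x} → ¬ Q x → ∀ k → ¬ Q (x ^ k)
  ∉-^ x∉Q zero    = proper
  ∉-^ x∉Q (suc k) = ∉-* x∉Q (∉-^ x∉Q k)

-- Orders at a prime ideal.

-- HasOrder x k says that x has order exactly k along b in the localization of R at Q.
module Order {c ℓ ℓ'} (R : CommutativeRing c ℓ) (domain : IsIntegralDomain R)
  (Q : CommutativeRing.Carrier R → Set ℓ') (prime-Q : IsPrimeIdeal R Q)
  (b : CommutativeRing.Carrier R) (b∈Q : Q b) (b≉0 : CommutativeRing._≉_ R b (CommutativeRing.0# R)) where
  open CommutativeRing R hiding (zero)
  open IsPrimeIdeal prime-Q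
  open PrimeIdeal R Q prime-Q
  open Domain R domain
  open RingSolver R
  open Algebra.Properties.CommutativeSemiring.Exp commutativeSemiring
  open Algebra.Properties.Semiring.Divisibility semiring using (_∤_; _,_)
  open import Relation.Binary.Reasoning.Setoid setoid

  record HasOrder (x : Carrier) (k : ℕ) : Set (c ⊔ ℓ ⊔ ℓ') where
    constructor hasOrder
    field
      cofactor   : Carrier
      cofactor∉Q : ¬ Q cofactor
      equality   : x ≈ b ^ k * cofactor

  HasOrder-resp-≈ : ∀ {x y k} → x ≈ y → HasOrder x k → HasOrder y k
  HasOrder-resp-≈ x≈y (hasOrder t t∉Q x≈bᵏt) = hasOrder t t∉Q (trans (sym x≈y) x≈bᵏt)

  HasOrder-1 : HasOrder 1# 0
  HasOrder-1 = hasOrder 1# proper (sym (*-identityˡ 1#))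

  HasOrder-* : ∀ {x y k l} → HasOrder x k → HasOrder y l → HasOrder (x * y) (k ℕ.+ l)
  HasOrder-* {x} {y} {k} {l} (hasOrder t t∉Q x≈bᵏt) (hasOrder u u∉Q y≈bˡu) = hasOrder (t * u) (∉-* t∉Q u∉Q) (begin
    x * y                       ≈⟨ *-cong x≈bᵏt y≈bˡu ⟩
    (b ^ k * t) * (b ^ l * u)   ≈⟨ solve 4 (λ x t y u → (x :* t) :* (y :* u) := (x :* y) :* (t :* u)) refl _ _ _ _ ⟩
    (b ^ k * b ^ l) * (t * u)   ≈⟨ *-congʳ (^-homo-* b k l) ⟨
    b ^ (k ℕ.+ l) * (t * u)     ∎)

  HasOrder-^ : ∀ {x k} → HasOrder x k → ∀ n → HasOrder (x ^ n) (n ℕ.* k)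
  HasOrder-^ x-ord zero    = HasOrder-1
  HasOrder-^ x-ord (suc n) = HasOrder-* x-ord (HasOrder-^ x-ord n)

  HasOrder-neg : ∀ {x k} → HasOrder x k → HasOrder (- x) k
  HasOrder-neg {x} {k} (hasOrder t t∉Q x≈bᵏt) =
    hasOrder (- t)
      (λ -t∈Q → t∉Q (respects (solve 1 (λ t → :- :- t := t) refl t) (neg-closed -t∈Q)))
      (trans (-‿cong x≈bᵏt) (solve 2 (λ y t → :- (y :* t) := y :* :- t) refl _ t))

  -- Sets apart one factor `b` of the surplus power; this factor is what puts the surplus into `Q`.
  ^-split : ∀ {k l} → k < l → b ^ l ≈ b ^ k * (b * b ^ (l ℕ.∸ suc k))
  ^-split {k} {l} k<l = begin
    b ^ l                               ≡⟨ ≡.cong (b ^_) (≡.trans (≡.sym (ℕ.m+[n∸m]≡n k<l)) (≡.sym (ℕ.+-suc k _))) ⟩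
    b ^ (k ℕ.+ suc (l ℕ.∸ suc k))       ≈⟨ ^-homo-* b k (suc (l ℕ.∸ suc k)) ⟩
    b ^ k * (b * b ^ (l ℕ.∸ suc k))     ∎

  -- The term of higher order changes the cofactor `t` only by a multiple of `b`, which cannot move
  -- it into `Q`.
  HasOrder-+ : ∀ {x y k l} → k < l → HasOrder x k → HasOrder y l → HasOrder (x + y) k
  HasOrder-+ {x} {y} {k} {l} k<l (hasOrder t t∉Q x≈bᵏt) (hasOrder u _ y≈bˡu) =
    hasOrder (t + b * v * u) (∉-+ t∉Q (absorbʳ u (absorbʳ v b∈Q))) (begin
      x + y                           ≈⟨ +-cong x≈bᵏt (trans y≈bˡu (*-congʳ (^-split k<l))) ⟩
      b ^ k * t + b ^ k * (b * v) * u ≈⟨ solve 4 (λ x t z u → x :* t :+ x :* z :* u := x :* (t :+ z :* u)) refl _ _ _ _ ⟩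
      b ^ k * (t + b * v * u)         ∎)
    where v = b ^ (l ℕ.∸ suc k)

  -- Otherwise cancelling `b ^ k` would make the cofactor `t` a multiple of `b`.
  HasOrder⇒∤ : ∀ {x k l} → HasOrder x k → k < l → b ^ l ∤ x
  HasOrder⇒∤ {x} {k} {l} (hasOrder t t∉Q x≈bᵏt) k<l (q , qbˡ≈x) =
    t∉Q (respects (sym t≈) (absorbʳ q (absorbʳ _ b∈Q)))
    where
    t≈ : t ≈ b * b ^ (l ℕ.∸ suc k) * q
    t≈ = *-cancelˡ (^-≉0 b≉0 k) (begin
      b ^ k * t                             ≈⟨ x≈bᵏt ⟨
      x                                     ≈⟨ qbˡ≈x ⟨
      q * b ^ l                             ≈⟨ *-comm _ _ ⟩
      b ^ l * q                             ≈⟨ *-congʳ (^-split k<l) ⟩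
      b ^ k * (b * b ^ (l ℕ.∸ suc k)) * q   ≈⟨ *-assoc _ _ _ ⟩
      b ^ k * (b * b ^ (l ℕ.∸ suc k) * q)   ∎)

-- Growth of orders under span polynomials.

-- The Newton polygon of spanPoly W when the elements of W have distinct orders.
module SpanOrder (n : ℕ) where
  spanOrder : List ℕ → ℕ → ℕ
  spanOrder []      k = k
  spanOrder (l ∷ W) k = spanOrder W k ℕ.+ n ℕ.* (spanOrder W k ⊓ spanOrder W l)

  spanOrder-mono-< : ∀ W {k l} → k < l → spanOrder W k < spanOrder W l
  spanOrder-mono-< []      k<l = k<l
  spanOrder-mono-< (j ∷ W) k<l = ℕ.+-mono-<-≤ (spanOrder-mono-< W k<l)
    (ℕ.*-monoʳ-≤ n (ℕ.⊓-monoˡ-≤ (spanOrder W j) (ℕ.<⇒≤ (spanOrder-mono-< W k<l))))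

  -- Orders that start distinct stay distinct, which excludes cancellation when the next generator
  -- is adjoined.
  spanOrder-injective : ∀ W {k l} → spanOrder W k ≡ spanOrder W l → k ≡ l
  spanOrder-injective W {k} {l} Φk≡Φl with ℕ.<-cmp k l
  ... | tri< k<l _ _ = ⊥-elim (ℕ.<⇒≢ (spanOrder-mono-< W k<l) Φk≡Φl)
  ... | tri≈ _ k≡l _ = k≡l
  ... | tri> _ _ l<k = ⊥-elim (ℕ.<⇒≢ (spanOrder-mono-< W l<k) (≡.sym Φk≡Φl))

  -- Bounding the minimum by its first argument, each entry costs at most a factor `suc n`, whatever
  -- its value.
  spanOrder-≤ : ∀ W k → spanOrder W k ≤ suc n ℕ.^ length W ℕ.* k
  spanOrder-≤ []      k = ℕ.≤-reflexive (≡.sym (ℕ.*-identityˡ k))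
  spanOrder-≤ (l ∷ W) k = begin
    spanOrder W k ℕ.+ n ℕ.* (spanOrder W k ⊓ spanOrder W l)
      ≤⟨ ℕ.+-monoʳ-≤ (spanOrder W k) (ℕ.*-monoʳ-≤ n (ℕ.m⊓n≤m (spanOrder W k) (spanOrder W l))) ⟩
    suc n ℕ.* spanOrder W k
      ≤⟨ ℕ.*-monoʳ-≤ (suc n) (spanOrder-≤ W k) ⟩
    suc n ℕ.* (suc n ℕ.^ length W ℕ.* k)
      ≡⟨ ℕ.*-assoc (suc n) (suc n ℕ.^ length W) k ⟨
    suc n ℕ.^ length (l ∷ W) ℕ.* k
      ∎
    where open ℕ.≤-Reasoning

module SpanPolyOrder {c ℓ ℓ'} (R : CommutativeRing c ℓ) (domain : IsIntegralDomain R) (m : ℕ)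
  (prime-p : Prime (suc (suc m))) (char-p : IsFpAlgebra R (suc (suc m)))
  (Q : CommutativeRing.Carrier R → Set ℓ') (prime-Q : IsPrimeIdeal R Q)
  (b : CommutativeRing.Carrier R) (b∈Q : Q b) (b≉0 : CommutativeRing._≉_ R b (CommutativeRing.0# R)) where
  open CommutativeRing R hiding (zero)
  open Frobenius R m prime-p char-p using (n; p)
  open AdditivePolynomials R domain m prime-p char-p
  open SpanOrder n
  open Order R domain Q prime-Q b b∈Q b≉0
  open Algebra.Properties.CommutativeSemiring.Exp commutativeSemiring

  -- The two terms have orders `p * k` and `n * l + k`, distinct because `k ≢ l`, so the smaller one
  -- prevails.
  HasOrder-AS : ∀ {α x l k} → HasOrder α l → HasOrder x k → k ≢ l →
                HasOrder (AS (α ^ n) x) (k ℕ.+ n ℕ.* (k ⊓ l))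
  HasOrder-AS {α} {x} {l} {k} α-ord x-ord k≢l with ℕ.<-cmp k l
  ... | tri< k<l _ _ rewrite ℕ.m≤n⇒m⊓n≡m (ℕ.<⇒≤ k<l) =
    HasOrder-+ (≡.subst (k ℕ.+ n ℕ.* k <_) (ℕ.+-comm k _) (ℕ.+-monoʳ-< k (ℕ.*-monoʳ-< n k<l)))
      (HasOrder-^ x-ord p) (HasOrder-neg (HasOrder-* (HasOrder-^ α-ord n) x-ord))
  ... | tri≈ _ k≡l _ = ⊥-elim (k≢l k≡l)
  ... | tri> _ _ l<k rewrite ℕ.m≥n⇒m⊓n≡n (ℕ.<⇒≤ l<k) | ℕ.+-comm k (n ℕ.* l) =
    HasOrder-resp-≈ (+-comm _ _)
      (HasOrder-+ (≡.subst (n ℕ.* l ℕ.+ k <_) (ℕ.+-comm _ k) (ℕ.+-monoˡ-< k (ℕ.*-monoʳ-< n l<k)))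
        (HasOrder-neg (HasOrder-* (HasOrder-^ α-ord n) x-ord)) (HasOrder-^ x-ord p))

  -- By induction `c i` and `c j` pass through the polynomial of `W` with distinct orders, so
  -- `HasOrder-AS` applies.
  spanPoly-order : ∀ {ι} {I : Set ι} (c : I → Carrier) (ν : I → ℕ) → (∀ {i j} → ν i ≡ ν j → i ≡ j) →
    (∀ i → HasOrder (c i) (ν i)) → ∀ W i → Unique (i ∷ W) →
    HasOrder (spanPoly (map c W) (c i)) (spanOrder (map ν W) (ν i))
  spanPoly-order c ν ν-inj c-ord []      i _ = c-ord i
  spanPoly-order c ν ν-inj c-ord (j ∷ W) i ((i≢j ∷ i∉W) ∷ (j∉W ∷ uniq)) =
    HasOrder-AS (spanPoly-order c ν ν-inj c-ord W j (j∉W ∷ uniq))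
                (spanPoly-order c ν ν-inj c-ord W i (i∉W ∷ uniq))
                (i≢j ∘ ν-inj ∘ spanOrder-injective (map ν W))

-- Shattering by independent subgroups.

module Shattering {c ℓ} (R : CommutativeRing c ℓ) where
  open CommutativeRing R hiding (zero)
  open RingSolver R
  open Semantics R
  open Algebra.Properties.CommutativeMonoid.Sum +-commutativeMonoid using (sum)

  record IsAdditiveSubgroup {h} (H : Carrier → Set h) : Set (c ⊔ ℓ ⊔ h) where
    field
      respects   : ∀ {x y} → x ≈ y → H x → H y
      zero∈      : H 0#
      +-closed   : ∀ {x y} → H x → H y → H (x + y)
      neg-closed : ∀ {x} → H x → H (- x)

  module _ {h} {H : Carrier → Set h} (isSubgroup : IsAdditiveSubgroup H) where
    open IsAdditiveSubgroup isSubgroup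

    sum∈ : ∀ {N} (t : Fin N → Carrier) → (∀ j → H (t j)) → H (sum t)
    sum∈ {zero}  t t∈H = zero∈
    sum∈ {suc N} t t∈H = +-closed (t∈H zero) (sum∈ (t ∘ suc) (t∈H ∘ suc))

    sum∈⇒∈ : ∀ {N} (t : Fin N → Carrier) i → (∀ j → j ≢ i → H (t j)) → H (sum t) → H (t i)
    sum∈⇒∈ t zero    t∈H ∑t∈H = respects (solve 2 (λ x y → (x :+ y) :- y := x) refl _ _)
      (+-closed ∑t∈H (neg-closed (sum∈ (t ∘ suc) (λ j → t∈H (suc j) (λ ())))))
    sum∈⇒∈ t (suc i) t∈H ∑t∈H = sum∈⇒∈ (t ∘ suc) i
      (λ j j≢i → t∈H (suc j) (j≢i ∘ Fin.suc-injective))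
      (respects (solve 2 (λ x y → (x :+ y) :- x := y) refl _ _)
        (+-closed ∑t∈H (neg-closed (t∈H zero (λ ())))))

  -- The parameter for `S` is the sum of the `t j` with `j` outside `S`: modulo `H i` only `t i` can
  -- survive, and it is a summand exactly when `S i` is false.
  independentSubgroups⇒Shatters : ∀ {k N h} (φ : Formula (k ℕ.+ 1)) (ρ : Fin N → Vec Carrier k)
    (H : Fin N → Carrier → Set h) → (∀ i → IsAdditiveSubgroup (H i)) →
    (∀ i x → Sat (ρ i ++ x ∷ []) φ ⇔ H i x) →
    (t : Fin N → Carrier) → (∀ i j → j ≢ i → H i (t j)) → (∀ i → ¬ H i (t i)) →
    Shatters k 1 φ N
  independentSubgroups⇒Shatters {k} {N} φ ρ H H-subgroup Sat⇔H t t∈H t∉H =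
    ρ , (λ S → sum (select S) ∷ []) , λ i S → mk⇔ (to⇒ i S) (from⇐ i S)
    where
    select : (Fin N → Bool) → Fin N → Carrier
    select S j = if S j then 0# else t j

    select∈H : ∀ S i j → j ≢ i → H i (select S j)
    select∈H S i j j≢i with S j
    ... | true  = IsAdditiveSubgroup.zero∈ (H-subgroup i)
    ... | false = t∈H i j j≢i

    to⇒ : ∀ i S → Sat (ρ i ++ sum (select S) ∷ []) φ → S i ≡ true
    -- Abstracting `S i` together with the membership lets `select S i` reduce to `t i` in the
    -- second case.
    to⇒ i S sat with S i | sum∈⇒∈ (H-subgroup i) (select S) i (select∈H S i) (to (Sat⇔H i _) sat)
    ... | true  | _    = ≡.refl
    ... | false | tᵢ∈H = ⊥-elim (t∉H i tᵢ∈H)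

    from⇐ : ∀ i S → S i ≡ true → Sat (ρ i ++ sum (select S) ∷ []) φ
    from⇐ i S Si≡true = from (Sat⇔H i _) (sum∈ (H-subgroup i) (select S) all∈H)
      where
      all∈H : ∀ j → H i (select S j)
      all∈H j with j Fin.≟ i
      ... | no j≢i     = select∈H S i j j≢i
      ... | yes ≡.refl rewrite Si≡true = IsAdditiveSubgroup.zero∈ (H-subgroup i)

-- Definability of the subgroups.

power : ∀ {n} → Term n → ℕ → Term n
power t zero    = one
power t (suc k) = mul t (power t k)

-- t = uᵖ - δu for some u = αr = βr′, in the variables r′, r, δ, α, β, t.
imageFormula : ℕ → Formula 4
imageFormula p = exists (exists (and
  (eq (mul (var (# 3)) (var (# 1))) (mul (var (# 4)) (var (# 0))))
  (eq (var (# 5)) (plus (power u p) (neg (mul (var (# 2)) u))))))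
  where u = mul (var (# 3)) (var (# 1))

-- The shattered configuration for incomparable primes.

module Incomparable {c ℓ ℓ'} (R : CommutativeRing c ℓ) (domain : IsIntegralDomain R) (m : ℕ)
  (prime-p : Prime (suc (suc m))) (char-p : IsFpAlgebra R (suc (suc m)))
  (P Q : CommutativeRing.Carrier R → Set ℓ') (prime-P : IsPrimeIdeal R P) (prime-Q : IsPrimeIdeal R Q)
  (a b : CommutativeRing.Carrier R) (a∈P : P a) (a∉Q : ¬ Q a) (b∈Q : Q b) (b∉P : ¬ P b) where
  open CommutativeRing R hiding (zero)
  open IsIntegralDomain domain
  open Frobenius R m prime-p char-p
  open AdditivePolynomials R domain m prime-p char-p
  open SpanOrder n
  open RingSolver R
  open Semantics R
  open Shattering R
  open Algebra.Properties.CommutativeSemiring.Exp commutativeSemiring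
  open Algebra.Properties.Group +-group using (x∙y⁻¹≈ε⇒x≈y; x≈y⇒x∙y⁻¹≈ε)
  open Algebra.Properties.Semiring.Divisibility semiring using (_∣_; _,_; _∣0; ∣ʳ-respʳ-≈)
  open import Relation.Binary.Reasoning.Setoid setoid
  module P where
    open IsPrimeIdeal prime-P public
    open PrimeIdeal R P prime-P public
  module Q where
    open IsPrimeIdeal prime-Q public
    open PrimeIdeal R Q prime-Q public

  a≉0 : a ≉ 0#
  a≉0 a≈0 = a∉Q (Q.respects (sym a≈0) Q.zero∈)

  b≉0 : b ≉ 0#
  b≉0 b≈0 = b∉P (P.respects (sym b≈0) P.zero∈)

  module OrderP = Order R domain P prime-P a a∈P a≉0
  module OrderQ = Order R domain Q prime-Q b b∈Q b≉0

  ∣-+ : ∀ {x y z} → x ∣ y → x ∣ z → x ∣ y + z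
  ∣-+ (q , qx≈y) (r , rx≈z) = q + r , trans (distribʳ _ q r) (+-cong qx≈y rx≈z)

  ∣-neg : ∀ {x y} → x ∣ y → x ∣ - y
  ∣-neg {x} (q , qx≈y) = - q , trans (solve 2 (λ q x → :- q :* x := :- (q :* x)) refl q x) (-‿cong qx≈y)

  -- The image of `αR ∩ βR` under `AS δ`; the cofactors `r` and `r′` make membership in the
  -- intersection first-order.
  Image : Carrier → Carrier → Carrier → Carrier → Set _
  Image δ α β t = ∃₂ λ r r′ → α * r ≈ β * r′ × t ≈ AS δ (α * r)

  Image-isAdditiveSubgroup : ∀ δ α β → IsAdditiveSubgroup (Image δ α β)
  Image-isAdditiveSubgroup δ α β = record
    { respects   = λ { x≈y (r , r′ , αr≈βr′ , x≈) → r , r′ , αr≈βr′ , trans (sym x≈y) x≈ }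
    ; zero∈      = 0# , 0# , trans (zeroʳ α) (sym (zeroʳ β)) , sym (trans (AS-cong refl (zeroʳ α)) (AS-0 δ))
    ; +-closed   = λ { (r , r′ , αr≈βr′ , x≈) (q , q′ , αq≈βq′ , y≈) →
        r + q , r′ + q′ ,
        trans (distribˡ α r q) (trans (+-cong αr≈βr′ αq≈βq′) (sym (distribˡ β r′ q′))) ,
        trans (+-cong x≈ y≈) (sym (trans (AS-cong refl (distribˡ α r q)) (AS-+ δ _ _))) }
    ; neg-closed = λ { (r , r′ , αr≈βr′ , x≈) →
        - r , - r′ ,
        trans (*-neg α r) (trans (-‿cong αr≈βr′) (sym (*-neg β r′))) ,
        trans (-‿cong x≈) (sym (trans (AS-cong refl (*-neg α r)) (AS-neg δ _))) }
    }
    where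
    *-neg : ∀ x y → x * - y ≈ - (x * y)
    *-neg = solve 2 (λ x y → x :* :- y := :- (x :* y)) refl

  evalT-power : ∀ {k} (ρ : Vec Carrier k) t j → evalT ρ (power t j) ≡ evalT ρ t ^ j
  evalT-power ρ t zero    = ≡.refl
  evalT-power ρ t (suc j) = ≡.cong (evalT ρ t *_) (evalT-power ρ t j)

  Sat-imageFormula : ∀ δ α β t → Sat (δ ∷ α ∷ β ∷ t ∷ []) (imageFormula p) ⇔ Image δ α β t
  Sat-imageFormula δ α β t = mk⇔
    (λ { (r , r′ , lift αr≈βr′ , lift t≈) → r , r′ , αr≈βr′ , trans t≈ (AS≈ r r′) })
    (λ { (r , r′ , αr≈βr′ , t≈) → r , r′ , lift αr≈βr′ , lift (trans t≈ (sym (AS≈ r r′))) })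
    where
    -- Only `power` needs an argument, its exponent containing the variable `m`; the rest evaluates
    -- by computation.
    AS≈ : ∀ r r′ → _
    AS≈ r r′ = +-congʳ (reflexive
      (evalT-power (r′ ∷ r ∷ δ ∷ α ∷ β ∷ t ∷ []) (mul (var (# 3)) (var (# 1))) p))

  module _ (N : ℕ) where
    -- By `spanOrder-≤` this bounds the orders of all `d i` at both primes, as list lengths and
    -- generator orders are at most `N`. The exponent `M` is `suc bound`.
    bound : ℕ
    bound = p ℕ.^ N ℕ.* N

    α β s : Carrier
    α = a ^ suc bound
    β = b ^ suc bound
    s = α + β

    -- Exactly one summand of `s` lies in `P`. With `s∉Q`, this keeps the orders of the generators
    -- independent of `M`.
    s∉P : ¬ P s
    s∉P s∈P = P.∉-+ (P.∉-^ b∉P (suc bound))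
      (P.absorbʳ _ a∈P) (P.respects (+-comm α β) s∈P)

    s∉Q : ¬ Q s
    s∉Q = Q.∉-+ (Q.∉-^ a∉Q (suc bound))
      (Q.absorbʳ _ b∈Q)

    -- The exponents of `a` fall while those of `b` rise, giving distinct orders at both primes.
    monomial point generator : Fin N → Carrier
    monomial i  = a ^ toℕ (opposite i) * b ^ toℕ i
    point i     = monomial i * β
    generator i = s * monomial i

    -- This is the purpose of `s = α + β`: a multiple of `α` separates each generator from a
    -- multiple of `β`.
    generator≈ : ∀ i → generator i ≈ point i + monomial i * α
    generator≈ i = solve 3 (λ α β c → (α :+ β) :* c := c :* β :+ c :* α) refl α β (monomial i)

    generator-orderP : ∀ i → OrderP.HasOrder (generator i) (toℕ (opposite i))
    generator-orderP i = OrderP.hasOrder (s * b ^ toℕ i)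
      (P.∉-* s∉P (P.∉-^ b∉P (toℕ i)))
      (solve 3 (λ s x y → s :* (x :* y) := x :* (s :* y)) refl _ _ _)

    generator-orderQ : ∀ i → OrderQ.HasOrder (generator i) (toℕ i)
    generator-orderQ i = OrderQ.hasOrder (s * a ^ toℕ (opposite i))
      (Q.∉-* s∉Q (Q.∉-^ a∉Q (toℕ (opposite i))))
      (solve 3 (λ s x y → s :* (x :* y) := y :* (s :* x)) refl _ _ _)

    -- Removing `i` only up to permutation suffices, by `spanPoly-↭`.
    extract : ∀ i → ∃ λ W → allFin N ↭ i ∷ W
    extract i with ∈-∃++ (∈-allFin i)
    ... | V , W , allFin≡ = V ++ₗ W , ↭.trans (↭.↭-reflexive allFin≡) (shift i V W)

    others : Fin N → List (Fin N)
    others i = proj₁ (extract i)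

    allFin↭ : ∀ i → allFin N ↭ i ∷ others i
    allFin↭ i = proj₂ (extract i)

    others-unique : ∀ i → Unique (i ∷ others i)
    others-unique i = Unique-resp-↭ (≡.setoid (Fin N)) (↭.↭⇒↭ₛ (allFin↭ i)) (allFin⁺ N)

    ∈-others : ∀ {i j} → i ≢ j → i ∈ others j
    ∈-others {i} {j} i≢j with ∈-resp-↭ (allFin↭ j) (∈-allFin i)
    ... | here i≡j = ⊥-elim (i≢j i≡j)
    ... | there i∈ = i∈

    spanPolyᵢ : Fin N → Carrier → Carrier
    spanPolyᵢ i = spanPoly (map generator (others i))

    d : Fin N → Carrier
    d i = spanPolyᵢ i (generator i)

    t : Fin N → Carrier
    t i = spanPoly (map generator (allFin N)) (point i)

    -- With the generator `j` moved to the head, the same `t i` becomes a value of `AS (d j ^ n)`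
    -- for every `j`.
    t≈ : ∀ i j → t i ≈ AS (d j ^ n) (spanPolyᵢ j (point i))
    t≈ i j = spanPoly-↭ (map⁺ generator (allFin↭ j)) (point i)

    β∣ : ∀ i j → β ∣ spanPolyᵢ j (point i)
    β∣ i j = spanPoly-∣ (map generator (others j)) (monomial i , refl)

    spanPolyᵢ-generator : ∀ i j →
      spanPolyᵢ j (generator i) ≈ spanPolyᵢ j (point i) + spanPolyᵢ j (monomial i * α)
    spanPolyᵢ-generator i j = trans (spanPoly-cong (map generator (others j)) (generator≈ i)) (spanPoly-+ (map generator (others j)) _ _)

    α∣ : ∀ i j → α ∣ spanPolyᵢ j (monomial i * α)
    α∣ i j = spanPoly-∣ (map generator (others j)) (monomial i , refl)

    t∈Image : ∀ i j → j ≢ i → Image (d i ^ n) α β (t j)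
    t∈Image i j j≢i = member α∣u (β∣ j i)
      where
      u = spanPolyᵢ i (point j)

      α∣u : α ∣ u
      -- As `j ≢ i`, `generator j` is a root of `spanPolyᵢ i`, so `u` is the negative of a multiple
      -- of `α`.
      α∣u = ∣ʳ-respʳ-≈
        (trans (+-congʳ (trans (sym (spanPoly-root (∈-map⁺ generator (∈-others j≢i)))) (spanPolyᵢ-generator j i)))
          (solve 2 (λ u v → (u :+ v) :- v := u) refl u _))
        (∣-+ (_ ∣0) (∣-neg (α∣ j i)))

      member : α ∣ u → β ∣ u → Image (d i ^ n) α β (t j)
      member (r , rα≈u) (r′ , r′β≈u) = r , r′ , trans αr≈u (sym (trans (*-comm β r′) r′β≈u)) ,
        trans (t≈ j i) (AS-cong refl (sym αr≈u))
        where αr≈u = trans (*-comm α r) rα≈u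

    spanOrder-bound : ∀ (ν : Fin N → ℕ) i → ν i ≤ N → spanOrder (map ν (others i)) (ν i) < suc bound
    spanOrder-bound ν i νᵢ≤N = s≤s (ℕ.≤-trans (spanOrder-≤ (map ν (others i)) (ν i))
      (ℕ.*-mono-≤ (ℕ.^-monoʳ-≤ p length≤N) νᵢ≤N))
      where
      length≤N : length (map ν (others i)) ≤ N
      -- The list has `N - 1` entries, rounded up to match `bound`.
      length≤N = ≡.subst₂ _≤_ (≡.sym (List.length-map ν (others i)))
        (≡.trans (≡.sym (↭-length (allFin↭ i))) (List.length-tabulate id)) (ℕ.n≤1+n _)

    α∤d : ∀ i → ¬ (α ∣ d i)
    α∤d i = OrderP.HasOrder⇒∤
      (SpanPolyOrder.spanPoly-order R domain m prime-p char-p P prime-P a a∈P a≉0 generator (toℕ ∘ opposite)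
        (opposite-injective ∘ Fin.toℕ-injective) generator-orderP (others i) i (others-unique i))
      (spanOrder-bound (toℕ ∘ opposite) i (ℕ.<⇒≤ (Fin.toℕ<n (opposite i))))
      where
      opposite-injective : ∀ {i j : Fin N} → opposite i ≡ opposite j → i ≡ j
      opposite-injective {i} {j} oi≡oj =
        ≡.trans (≡.sym (Fin.opposite-involutive i)) (≡.trans (≡.cong opposite oi≡oj) (Fin.opposite-involutive j))

    -- Stated for `n`-th powers because the comparison in `t∉Image` yields only `wⁿ = dᵢⁿ`.
    βⁿ∤dⁿ : ∀ i → ¬ (b ^ (n ℕ.* suc bound) ∣ d i ^ n)
    βⁿ∤dⁿ i = OrderQ.HasOrder⇒∤
      (OrderQ.HasOrder-^ (SpanPolyOrder.spanPoly-order R domain m prime-p char-p Q prime-Q b b∈Q b≉0 generator toℕ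
        Fin.toℕ-injective generator-orderQ (others i) i (others-unique i)) n)
      (ℕ.*-monoʳ-< n (spanOrder-bound toℕ i (ℕ.<⇒≤ (Fin.toℕ<n i))))

    -- Another preimage of t i would differ from u by some w with wᵖ = dᵢⁿ w and β ∣ w.
    t∉Image : ∀ i → ¬ Image (d i ^ n) α β (t i)
    t∉Image i (r , r′ , αr≈βr′ , tᵢ≈) with β∣ i i
    ... | q , qβ≈u = [ w≉0 , wⁿ≉dⁿ ]′ (noZeroDivisor w (w ^ n - δ) (begin
      w * (w ^ n - δ)      ≈⟨ solve 3 (λ w wn δ → w :* (wn :- δ) := w :* wn :- δ :* w) refl w (w ^ n) δ ⟩
      AS δ w               ≈⟨ trans (AS-+ δ _ _) (+-congˡ (AS-neg δ u)) ⟩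
      AS δ (α * r) - AS δ u ≈⟨ x≈y⇒x∙y⁻¹≈ε (trans (sym tᵢ≈) (t≈ i i)) ⟩
      0#                   ∎))
      where
      u = spanPolyᵢ i (point i)
      δ = d i ^ n
      w = α * r - u

      w≉0 : w ≉ 0#
      -- If `w` vanished, `u` would equal `α * r`, and `α` would divide `d i`, which is `u` plus a
      -- multiple of `α`.
      w≉0 w≈0 = α∤d i (∣ʳ-respʳ-≈ (sym (spanPolyᵢ-generator i i))
        (∣-+ (r , trans (*-comm r α) (x∙y⁻¹≈ε⇒x≈y _ _ w≈0)) (α∣ i i)))

      w≈ : w ≈ (r′ - q) * β
      w≈ = trans (+-cong αr≈βr′ (-‿cong (sym qβ≈u)))
        (solve 3 (λ β r q → β :* r :- q :* β := (r :- q) :* β) refl β r′ q)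

      wⁿ≉dⁿ : w ^ n - δ ≉ 0#
      -- Since `β` divides `w`, `βⁿ` would divide `wⁿ = dᵢⁿ`.
      wⁿ≉dⁿ wⁿ-δ≈0 = βⁿ∤dⁿ i ((r′ - q) ^ n , (begin
        (r′ - q) ^ n * b ^ (n ℕ.* suc bound)   ≈⟨ *-congˡ (trans (^-assocʳ b (suc bound) n) (^-congʳ b (ℕ.*-comm (suc bound) n))) ⟨
        (r′ - q) ^ n * β ^ n                   ≈⟨ ^-distrib-* (r′ - q) β n ⟨
        ((r′ - q) * β) ^ n                     ≈⟨ ^-congˡ n w≈ ⟨
        w ^ n                                  ≈⟨ x∙y⁻¹≈ε⇒x≈y _ _ wⁿ-δ≈0 ⟩
        δ                                      ∎))

    -- The formula depends on `p` alone; `N` enters only through the parameters, so one formula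
    -- refutes NIP.
    shatters : Shatters 3 1 (imageFormula p) N
    shatters = independentSubgroups⇒Shatters (imageFormula p) (λ i → d i ^ n ∷ α ∷ β ∷ [])
      (λ i → Image (d i ^ n) α β) (λ i → Image-isAdditiveSubgroup _ α β)
      (λ i → Sat-imageFormula _ α β) t t∈Image t∉Image

  ¬NIP : ¬ NIP R
  ¬NIP nip with nip 3 1 (imageFormula p)
  ... | N , ¬shatters = ¬shatters (shatters N)

-- Comparability of the primes by excluded middle.

theorem3p8 : ∀ {c ℓ ℓ'} → ExcludedMiddle (c ⊔ ℓ ⊔ ℓ') →
    (p : ℕ) → Prime p → (R : CommutativeRing c ℓ) →
    IsFpAlgebra R p → NIP R → IsIntegralDomain R →
    (P Q : CommutativeRing.Carrier R → Set ℓ') →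
    IsPrimeIdeal R P → IsPrimeIdeal R Q →
    (P ⊆ₚ Q) ⊎ (Q ⊆ₚ P)
theorem3p8 em 0 prime-p = ⊥-elim (¬prime[0] prime-p)
theorem3p8 em 1 prime-p = ⊥-elim (¬prime[1] prime-p)
theorem3p8 {c} {ℓ} {ℓ'} em (suc (suc m)) prime-p R char-p nip domain P Q prime-P prime-Q =
  conclude (⊆-or-∃∉ P Q) (⊆-or-∃∉ Q P)
  where
  open CommutativeRing R using (Carrier)

  decide : ∀ (A : Set (c ⊔ ℓ')) → Dec A
  decide A with em {Lift ℓ A}
  ... | yes (lift x) = yes x
  ... | no ¬x        = no (¬x ∘ lift)

  ⊆-or-∃∉ : ∀ (A B : Carrier → Set ℓ') → (A ⊆ₚ B) ⊎ ∃ λ x → A x × ¬ B x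
  ⊆-or-∃∉ A B with decide (∃ λ x → A x × ¬ B x)
  ... | yes ∃∉ = inj₂ ∃∉
  -- The absence of a witness gives membership in `B` only doubly negated, and excluded middle
  -- removes the negations.
  ... | no ¬∃∉ = inj₁ λ x x∈A → lower (decidable-stable (decide (Lift c (B x)))
                   (λ ¬x∈B → ¬∃∉ (x , x∈A , ¬x∈B ∘ lift)))

  conclude : (P ⊆ₚ Q) ⊎ (∃ λ x → P x × ¬ Q x) → (Q ⊆ₚ P) ⊎ (∃ λ x → Q x × ¬ P x) →
             (P ⊆ₚ Q) ⊎ (Q ⊆ₚ P)
  conclude (inj₁ P⊆Q) _          = inj₁ P⊆Q
  conclude _          (inj₁ Q⊆P) = inj₂ Q⊆P
  conclude (inj₂ (a , a∈P , a∉Q)) (inj₂ (b , b∈Q , b∉P)) = ⊥-elim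
    (Incomparable.¬NIP R domain m prime-p char-p P Q prime-P prime-Q a b a∈P a∉Q b∈Q b∉P nip)
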